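{- For every integer $L\geq 2$, the following coefficientwise inequality of formal power series in $q$ holds: $$ \frac{1}{(q;q^2)_{L-1}}\left(\frac{1-q^{2L-2}}{1-q^2}+q^3\genfrac{[}{]}{0pt}{}{L-1}{2}_{q^2}\right)\ \succeq\ q\,\genfrac{[}{]}{0pt}{}{2L-2}{2}_{q}\,(-q^3;q)_{2L-4}. $$
   Context: The $q$-Pochhammer symbol is $(a;q)_N=\prod_{j=0}^{N-1}(1-aq^j)$ for integers $N\ge 0$, with $(a;q)_0=1$; in particular $(q;q^2)_N=\prod_{j=0}^{N-1}(1-q^{2j+1})$ and $(-q^3;q)_N=\prod_{j=0}^{N-1}(1+q^{3+j})$. The Gaussian polynomial is $\genfrac{[}{]}{0pt}{}{m}{n}_{q}=\frac{(q;q)_m}{(q;q)_n(q;q)_{m-n}}$ for integers $m\ge n\ge 0$, and it equals $0$ otherwise; $\genfrac{[}{]}{0pt}{}{m}{n}_{q^2}$ denotes the same polynomial with $q$ replaced by $q^2$. Reciprocals are expanded as formal power series in $q$. For formal power series $A(q),B(q)$ in $q$, $A(q)\succeq B(q)$ means that every coefficient of $A(q)-B(q)$ is nonnegative. -}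

module Defs where

open import Algebra.Bundles.Raw using (RawRing)
import Algebra.Definitions.RawMonoid as RawMonoidDefinitions
import Algebra.Definitions.RawSemiring as RawSemiringDefinitions
import Algebra.Properties.Semiring.Sum as SemiringSum
open import Data.Fin.Base using (Fin; zero; suc; toℕ)
open import Data.Integer.Base as ℤ using (ℤ; 0ℤ; 1ℤ)
import Data.Integer.Properties as ℤ
open import Data.Nat.Base as ℕ using (ℕ; zero; suc; _∸_)
open import Data.Nat.Properties using (_≤?_)
open import Data.Vec.Base using (Vec; []; _∷_; head; lookup)
open import Level using (0ℓ)
open import Relation.Binary.PropositionalEquality
open import Relation.Nullary.Decidable using (yes; no)

open SemiringSum ℤ.+-*-semiring using (sum-syntax; sum⁺-syntax; sum-cong-≗)

infixl 6 _+_ _-_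
infixl 7 _*_ _/_
infix  8 -_
infix  4 _≈_ _⪰_

-- ℤ⟦q⟧: a series is its coefficient function, with q the formal variable.
PowerSeries : Set
PowerSeries = ℕ → ℤ

_≈_ : PowerSeries → PowerSeries → Set
f ≈ g = ∀ n → f n ≡ g n

0# : PowerSeries
0# _ = 0ℤ

1# : PowerSeries
1# zero    = 1ℤ
1# (suc _) = 0ℤ

q : PowerSeries
q 1 = 1ℤ
q _ = 0ℤ

_+_ : PowerSeries → PowerSeries → PowerSeries
(f + g) n = f n ℤ.+ g n

-_ : PowerSeries → PowerSeries
(- f) n = ℤ.- f n

_-_ : PowerSeries → PowerSeries → PowerSeries
f - g = f + - g

_*_ : PowerSeries → PowerSeries → PowerSeries
(f * g) n = ∑[ i ≤ n ] (f (toℕ i) ℤ.* g (n ∸ toℕ i))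

rawRing : RawRing 0ℓ 0ℓ
rawRing = record
  { Carrier = PowerSeries
  ; _≈_     = _≈_
  ; _+_     = _+_
  ; _*_     = _*_
  ; -_      = -_
  ; 0#      = 0#
  ; 1#      = 1#
  }

open RawSemiringDefinitions (RawRing.rawSemiring rawRing) public using (_^_)

∏-syntax : ∀ n → (Fin n → PowerSeries) → PowerSeries
∏-syntax _ = RawMonoidDefinitions.sum (RawRing.*-rawMonoid rawRing)

infixl 10 ∏-syntax
syntax ∏-syntax n (λ i → x) = ∏[ i < n ] x

-- The coefficients g n, …, g 0 (highest first) of the reciprocal g of f,
-- obtained by solving f * g ≈ 1# for g (suc n); assumes f 0 ≡ 1.
recipCoeffs : PowerSeries → ∀ n → Vec ℤ (suc n)
recipCoeffs f zero    = 1ℤ ∷ []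
recipCoeffs f (suc n) =
  ℤ.- (∑[ i ≤ n ] (f (suc (toℕ i)) ℤ.* lookup (recipCoeffs f n) i))
    ∷ recipCoeffs f n

-- Meaningful only for series with constant term 1 (see *-recip); every
-- series used as a denominator here has constant term 1.
recip : PowerSeries → PowerSeries
recip f n = head (recipCoeffs f n)

_/_ : PowerSeries → PowerSeries → PowerSeries
f / g = f * recip g

lookup-recipCoeffs : ∀ f n (i : Fin (suc n)) →
                     lookup (recipCoeffs f n) i ≡ recip f (n ∸ toℕ i)
lookup-recipCoeffs f zero    zero    = refl
lookup-recipCoeffs f (suc n) zero    = refl
lookup-recipCoeffs f (suc n) (suc i) = lookup-recipCoeffs f n i

*-recip : ∀ f → f 0 ≡ 1ℤ → f * recip f ≈ 1#
*-recip f f₀≡1 zero rewrite f₀≡1 = refl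
*-recip f f₀≡1 (suc n) = begin
  f 0 ℤ.* recip f (suc n) ℤ.+ S  ≡⟨ cong (λ c → c ℤ.* recip f (suc n) ℤ.+ S) f₀≡1 ⟩
  1ℤ ℤ.* recip f (suc n) ℤ.+ S   ≡⟨ cong (ℤ._+ S) (ℤ.*-identityˡ (recip f (suc n))) ⟩
  ℤ.- T ℤ.+ S                    ≡⟨ cong (λ s → ℤ.- s ℤ.+ S) T≡S ⟩
  ℤ.- S ℤ.+ S                    ≡⟨ ℤ.+-inverseˡ S ⟩
  0ℤ                             ∎
  where
  open ≡-Reasoning
  S T : ℤ
  S = ∑[ i ≤ n ] (f (suc (toℕ i)) ℤ.* recip f (n ∸ toℕ i))
  T = ∑[ i ≤ n ] (f (suc (toℕ i)) ℤ.* lookup (recipCoeffs f n) i)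
  T≡S : T ≡ S
  T≡S = sum-cong-≗ {suc n} (λ i → cong (f (suc (toℕ i)) ℤ.*_) (lookup-recipCoeffs f n i))

-- ⟨ a ⨾ b ⟩ N is (a;b)_N; the base b is itself a series, so that b can be
-- q or q ^ 2.
⟨_⨾_⟩_ : PowerSeries → PowerSeries → ℕ → PowerSeries
⟨ a ⨾ b ⟩ N = ∏[ j < N ] (1# - a * b ^ toℕ j)

-- gaussian b m n is the Gaussian polynomial [m, n] in base b.
gaussian : PowerSeries → ℕ → ℕ → PowerSeries
gaussian b m n with n ≤? m
... | yes _ = (⟨ b ⨾ b ⟩ m) / ((⟨ b ⨾ b ⟩ n) * (⟨ b ⨾ b ⟩ (m ∸ n)))
... | no  _ = 0#

_⪰_ : PowerSeries → PowerSeries → Set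
A ⪰ B = ∀ n → 0ℤ ℤ.≤ (A - B) n

{-# OPTIONS --safe #-}

-- Put N = L - 1, P = (1 - q^(2N))/(1 - q²), S = (1 - q^(2N-1))/(1 - q),
-- E = 1/((1 - q⁴)(q³;q²)_(N-1)) and F = (-q³;q)_(2N-2). The difference of the
-- two sides equals
--   P ((1 + q³ + q^(2N)) E + q S (E - F)),
-- and P, S, E have nonnegative coefficients, so it suffices that E ⪰ F. Cut F
-- at M = N - 1 factors: F = K (-a;q)_M with K = (-q³;q)_M and a = q^(M+3).
-- Induction on M gives E = K / ((1 - q^(2M+4)) (a;q)_M), and
-- 1/(a;q)_M ⪰ (-a;q)_M factor by factor, since 1/(1 - x) ⪰ 1 + x.
module Submission where

open import Algebra.Bundles using (CommutativeRing)
import Algebra.Properties.AbelianGroup as AbelianGroupProperties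
import Algebra.Properties.CommutativeSemiring.Exp as Exp
import Algebra.Properties.Monoid.Sum as MonoidSum
import Algebra.Properties.Ring as RingProperties
import Algebra.Properties.Semiring.Mult.TCOptimised as Mult
import Algebra.Solver.Ring as Solver
import Algebra.Solver.Ring.AlmostCommutativeRing as ACR
open import Data.Fin.Base using (toℕ)
open import Data.Integer.Base as ℤ using (ℤ; +_; -[1+_]; 0ℤ; 1ℤ)
import Data.Integer.Properties as ℤ
import Data.Maybe.Base as Maybe
open import Data.Nat.Base as ℕ using (ℕ; zero; suc; _∸_; _≤_)
import Data.Nat.Properties as ℕ
open import Data.Product.Base using (_,_)
open import Data.Sum.Base using (inj₁; inj₂)
open import Function.Base using (_∘_)
open import Level as Level using (0ℓ; _⊔_)
import Relation.Binary.Reasoning.Setoid as SetoidReasoning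
open import Relation.Binary.PropositionalEquality as ≡ using (_≡_)
open import Relation.Nullary.Decidable using (dec⇒maybe)

-- Integer coefficients for solving equations in a commutative ring.

module IntegerCoefficients {c ℓ} (R : CommutativeRing c ℓ) where
  open CommutativeRing R
  open RingProperties ring
  open AbelianGroupProperties +-abelianGroup using (⁻¹-∙-comm)
  open Mult semiring
  open SetoidReasoning setoid

  -- The canonical homomorphism from the integers. With coefficients in ℤ, where equality is
  -- decidable, the solver can recognise cancelling terms.
  ⟦_⟧ : ℤ → Carrier
  ⟦ + n ⟧      = n × 1#
  ⟦ -[1+ n ] ⟧ = - (suc n × 1#)

  ⟦-⟧-homo : ∀ i → ⟦ ℤ.- i ⟧ ≈ - ⟦ i ⟧
  ⟦-⟧-homo (+ zero)  = sym -0#≈0#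
  ⟦-⟧-homo (+ suc n) = refl
  ⟦-⟧-homo -[1+ n ]  = sym (-‿involutive _)

  ⟦⊖⟧-homo : ∀ m n → ⟦ m ℤ.⊖ n ⟧ ≈ m × 1# - n × 1#
  ⟦⊖⟧-homo m       zero    = sym (trans (+-congˡ -0#≈0#) (+-identityʳ _))
  ⟦⊖⟧-homo zero    (suc n) = sym (+-identityˡ _)
  ⟦⊖⟧-homo (suc m) (suc n) = begin
    ⟦ suc m ℤ.⊖ suc n ⟧                    ≡⟨ ≡.cong ⟦_⟧ (ℤ.[1+m]⊖[1+n]≡m⊖n m n) ⟩
    ⟦ m ℤ.⊖ n ⟧                            ≈⟨ ⟦⊖⟧-homo m n ⟩
    m × 1# - n × 1#                        ≈⟨ +-identityˡ _ ⟨
    0# + (m × 1# - n × 1#)                 ≈⟨ +-congʳ (-‿inverseʳ 1#) ⟨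
    (1# - 1#) + (m × 1# - n × 1#)          ≈⟨ +-assoc _ _ _ ⟩
    1# + (- 1# + (m × 1# - n × 1#))        ≈⟨ +-congˡ (+-assoc _ _ _) ⟨
    1# + (- 1# + m × 1# - n × 1#)          ≈⟨ +-congˡ (+-congʳ (+-comm _ _)) ⟩
    1# + (m × 1# - 1# - n × 1#)            ≈⟨ +-congˡ (+-assoc _ _ _) ⟩
    1# + (m × 1# + (- 1# - n × 1#))        ≈⟨ +-assoc _ _ _ ⟨
    (1# + m × 1#) + (- 1# - n × 1#)        ≈⟨ +-cong (sym (1+× m 1#)) (⁻¹-∙-comm _ _) ⟩
    suc m × 1# - (1# + n × 1#)             ≈⟨ +-congˡ (-‿cong (1+× n 1#)) ⟨
    suc m × 1# - suc n × 1#                ∎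

  ⟦+⟧-homo : ∀ i j → ⟦ i ℤ.+ j ⟧ ≈ ⟦ i ⟧ + ⟦ j ⟧
  ⟦+⟧-homo (+ m)    (+ n)    = ×-homo-+ 1# m n
  ⟦+⟧-homo (+ m)    -[1+ n ] = ⟦⊖⟧-homo m (suc n)
  ⟦+⟧-homo -[1+ m ] (+ n)    = trans (⟦⊖⟧-homo n (suc m)) (+-comm _ _)
  ⟦+⟧-homo -[1+ m ] -[1+ n ] = begin
    - (suc (suc (m ℕ.+ n)) × 1#)       ≡⟨ ≡.cong (λ k → - (suc k × 1#)) (ℕ.+-suc m n) ⟨
    - ((suc m ℕ.+ suc n) × 1#)         ≈⟨ -‿cong (×-homo-+ 1# (suc m) (suc n)) ⟩
    - (suc m × 1# + suc n × 1#)        ≈⟨ ⁻¹-∙-comm _ _ ⟨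
    - (suc m × 1#) - (suc n × 1#)      ∎

  ⟦*⟧-homo-pos : ∀ m j → ⟦ + m ℤ.* j ⟧ ≈ ⟦ + m ⟧ * ⟦ j ⟧
  ⟦*⟧-homo-pos m (+ n) = begin
    ⟦ + m ℤ.* + n ⟧     ≡⟨ ≡.cong ⟦_⟧ (ℤ.pos-* m n) ⟨
    (m ℕ.* n) × 1#      ≈⟨ ×1-homo-* m n ⟩
    m × 1# * n × 1#     ∎
  ⟦*⟧-homo-pos m -[1+ n ] = begin
    ⟦ + m ℤ.* -[1+ n ] ⟧          ≡⟨ ≡.cong ⟦_⟧ (ℤ.neg-distribʳ-* (+ m) (+ suc n)) ⟨
    ⟦ ℤ.- (+ m ℤ.* + suc n) ⟧     ≈⟨ ⟦-⟧-homo (+ m ℤ.* + suc n) ⟩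
    - ⟦ + m ℤ.* + suc n ⟧         ≈⟨ -‿cong (⟦*⟧-homo-pos m (+ suc n)) ⟩
    - (m × 1# * suc n × 1#)       ≈⟨ -‿distribʳ-* _ _ ⟩
    m × 1# * - (suc n × 1#)       ∎

  ⟦*⟧-homo : ∀ i j → ⟦ i ℤ.* j ⟧ ≈ ⟦ i ⟧ * ⟦ j ⟧
  ⟦*⟧-homo (+ m)    j = ⟦*⟧-homo-pos m j
  ⟦*⟧-homo -[1+ m ] j = begin
    ⟦ -[1+ m ] ℤ.* j ⟧         ≡⟨ ≡.cong ⟦_⟧ (ℤ.neg-distribˡ-* (+ suc m) j) ⟨
    ⟦ ℤ.- (+ suc m ℤ.* j) ⟧    ≈⟨ ⟦-⟧-homo (+ suc m ℤ.* j) ⟩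
    - ⟦ + suc m ℤ.* j ⟧        ≈⟨ -‿cong (⟦*⟧-homo-pos (suc m) j) ⟩
    - (suc m × 1# * ⟦ j ⟧)     ≈⟨ -‿distribˡ-* _ _ ⟩
    - (suc m × 1#) * ⟦ j ⟧     ∎

  ℤ⟶R : ACR._-Raw-AlmostCommutative⟶_ ℤ.+-*-rawRing (ACR.fromCommutativeRing R)
  ℤ⟶R = record
    { ⟦_⟧    = ⟦_⟧
    ; +-homo = ⟦+⟧-homo
    ; *-homo = ⟦*⟧-homo
    ; -‿homo = ⟦-⟧-homo
    ; 0-homo = refl
    ; 1-homo = refl
    }

  open Solver ℤ.+-*-rawRing (ACR.fromCommutativeRing R) ℤ⟶R
    (λ i j → Maybe.map (reflexive ∘ ≡.cong ⟦_⟧) (dec⇒maybe (i ℤ.≟ j))) public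
    hiding (⟦_⟧)

2*[1+n] : ∀ n → 2 ℕ.* suc n ≡ 2 ℕ.+ (n ℕ.+ n)
2*[1+n] n = ≡.cong suc (≡.trans (ℕ.+-suc n _) (≡.cong (λ k → suc (n ℕ.+ k)) (ℕ.+-identityʳ n)))

-- Pochhammer identities over an arbitrary commutative ring.

module Pochhammer {κ ℓ} (R : CommutativeRing κ ℓ) where
  open CommutativeRing R
  open Exp commutativeSemiring
  open MonoidSum *-monoid using () renaming (sum to ∏; sum-cong-≋ to ∏-cong)
  open IntegerCoefficients R using (solve; con; _:=_; _:+_; _:*_; _:-_; :-_; _:^_)
  open SetoidReasoning setoid

  inverse-unique : ∀ {x y z} → x * y ≈ 1# → x * z ≈ 1# → y ≈ z
  inverse-unique {x} {y} {z} xy≈1 xz≈1 = begin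
    y            ≈⟨ *-identityʳ y ⟨
    y * 1#       ≈⟨ *-congˡ xz≈1 ⟨
    y * (x * z)  ≈⟨ solve 3 (λ x y z → y :* (x :* z) := (x :* y) :* z) refl x y z ⟩
    (x * y) * z  ≈⟨ *-congʳ xy≈1 ⟩
    1# * z       ≈⟨ *-identityˡ z ⟩
    z            ∎

  *-inverse : ∀ {x y x′ y′} → x * x′ ≈ 1# → y * y′ ≈ 1# → (x * y) * (x′ * y′) ≈ 1#
  *-inverse {x} {y} {x′} {y′} xx′≈1 yy′≈1 = begin
    (x * y) * (x′ * y′)  ≈⟨ solve 4 (λ x y x′ y′ → (x :* y) :* (x′ :* y′) := (x :* x′) :* (y :* y′)) refl x y x′ y′ ⟩
    (x * x′) * (y * y′)  ≈⟨ *-cong xx′≈1 yy′≈1 ⟩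
    1# * 1#              ≈⟨ *-identityˡ 1# ⟩
    1#                   ∎

  ∏-snoc : ∀ (h : ℕ → Carrier) n → ∏ {suc n} (h ∘ toℕ) ≈ ∏ {n} (h ∘ toℕ) * h n
  ∏-snoc h zero    = *-comm (h 0) 1#
  ∏-snoc h (suc n) = begin
    h 0 * ∏ {suc n} (h ∘ suc ∘ toℕ)            ≈⟨ *-congˡ (∏-snoc (h ∘ suc) n) ⟩
    h 0 * (∏ {n} (h ∘ suc ∘ toℕ) * h (suc n))  ≈⟨ *-assoc _ _ _ ⟨
    h 0 * ∏ {n} (h ∘ suc ∘ toℕ) * h (suc n)    ∎

  -- At `powerSeriesRing` this unfolds to the operation used in the theorem, so the identities below
  -- carry over without conversion.
  ⟨_⨾_⟩_ : Carrier → Carrier → ℕ → Carrier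
  ⟨ a ⨾ b ⟩ n = ∏ {n} (λ j → 1# - a * b ^ toℕ j)

  ⟨⨾⟩-snoc : ∀ a b n → ⟨ a ⨾ b ⟩ suc n ≈ ⟨ a ⨾ b ⟩ n * (1# - a * b ^ n)
  ⟨⨾⟩-snoc a b = ∏-snoc (λ j → 1# - a * b ^ j)

  ⟨⨾⟩-cong : ∀ {a a′} b n → a ≈ a′ → ⟨ a ⨾ b ⟩ n ≈ ⟨ a′ ⨾ b ⟩ n
  ⟨⨾⟩-cong b n a≈a′ = ∏-cong {n} (λ j → +-congˡ (-‿cong (*-congʳ a≈a′)))

  ⟨⨾⟩-+ : ∀ a b m n → ⟨ a ⨾ b ⟩ (m ℕ.+ n) ≈ ⟨ a ⨾ b ⟩ m * ⟨ a * b ^ m ⨾ b ⟩ n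
  ⟨⨾⟩-+ a b m zero rewrite ℕ.+-identityʳ m = sym (*-identityʳ _)
  ⟨⨾⟩-+ a b m (suc n) rewrite ℕ.+-suc m n = begin
    ⟨ a ⨾ b ⟩ suc (m ℕ.+ n)
      ≈⟨ ⟨⨾⟩-snoc a b (m ℕ.+ n) ⟩
    ⟨ a ⨾ b ⟩ (m ℕ.+ n) * (1# - a * b ^ (m ℕ.+ n))
      ≈⟨ *-cong (⟨⨾⟩-+ a b m n) (+-congˡ (-‿cong (trans (*-congˡ (^-homo-* b m n)) (sym (*-assoc _ _ _))))) ⟩
    ⟨ a ⨾ b ⟩ m * ⟨ a * b ^ m ⨾ b ⟩ n * (1# - a * b ^ m * b ^ n)
      ≈⟨ *-assoc _ _ _ ⟩
    ⟨ a ⨾ b ⟩ m * (⟨ a * b ^ m ⨾ b ⟩ n * (1# - a * b ^ m * b ^ n))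
      ≈⟨ *-congˡ (⟨⨾⟩-snoc (a * b ^ m) b n) ⟨
    ⟨ a ⨾ b ⟩ m * ⟨ a * b ^ m ⨾ b ⟩ suc n ∎

  ⟨⨾⟩-cons : ∀ a b n → ⟨ a ⨾ b ⟩ suc n ≈ (1# - a) * ⟨ a * b ⨾ b ⟩ n
  ⟨⨾⟩-cons a b n = trans (⟨⨾⟩-+ a b 1 n)
    (*-cong (solve 1 (λ a → (con 1ℤ :- a :* con 1ℤ) :* con 1ℤ := con 1ℤ :- a) refl a)
            (⟨⨾⟩-cong b n (*-congˡ (*-identityʳ b))))

  b*b^n : ∀ b n → (b ^ 2) ^ n ≈ b ^ n * b ^ n
  b*b^n b n = trans (^-distrib-* b (b * 1#) n) (*-congˡ (^-congˡ n (*-identityʳ b)))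

  b²^[1+n] : ∀ b n → (b ^ 2) ^ suc n ≈ b ^ (2 ℕ.+ (n ℕ.+ n))
  b²^[1+n] b n = trans (^-assocʳ b 2 (suc n))
    (^-congʳ b (2*[1+n] n))

  -- With a = q³ and T_M = (aq^M;q)_M, the identity
  -- (1 - aq^M) T_(M+1) = T_M (1 - aq^(2M)) (1 - aq^(2M+1)) drives the induction.
  dissection : ∀ q M →
    ⟨ - (q ^ 3) ⨾ q ⟩ M * ((1# - q ^ 4) * ⟨ q ^ 3 ⨾ q ^ 2 ⟩ M)
      ≈ (1# - q ^ 4 * (q ^ M * q ^ M)) * ⟨ q ^ 3 * q ^ M ⨾ q ⟩ M
  dissection q zero =
    solve 1 (λ q → con 1ℤ :* ((con 1ℤ :- q :^ 4) :* con 1ℤ)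
                := (con 1ℤ :- q :^ 4 :* (con 1ℤ :* con 1ℤ)) :* con 1ℤ) refl q
  dissection q (suc M) = begin
    ⟨ - (q ^ 3) ⨾ q ⟩ suc M * ((1# - q ^ 4) * ⟨ q ^ 3 ⨾ q ^ 2 ⟩ suc M)
      ≈⟨ *-cong (⟨⨾⟩-snoc (- (q ^ 3)) q M)
           (*-congˡ (trans (⟨⨾⟩-snoc (q ^ 3) (q ^ 2) M)
              (*-congˡ (+-congˡ (-‿cong (*-congˡ (b*b^n q M))))))) ⟩
    K * (1# - (- (q ^ 3)) * c) * ((1# - q ^ 4) * (Z * (1# - q ^ 3 * (c * c))))
      ≈⟨ solve 4 (λ q c K Z →
           K :* (con 1ℤ :- (:- (q :^ 3)) :* c) :* ((con 1ℤ :- q :^ 4) :* (Z :* (con 1ℤ :- q :^ 3 :* (c :* c))))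
           := (con 1ℤ :+ q :^ 3 :* c) :* (con 1ℤ :- q :^ 3 :* (c :* c)) :* (K :* ((con 1ℤ :- q :^ 4) :* Z)))
           refl q c K Z ⟩
    (1# + q ^ 3 * c) * (1# - q ^ 3 * (c * c)) * (K * ((1# - q ^ 4) * Z))
      ≈⟨ *-congˡ (dissection q M) ⟩
    (1# + q ^ 3 * c) * (1# - q ^ 3 * (c * c)) * ((1# - q ^ 4 * (c * c)) * T)
      ≈⟨ solve 3 (λ q c T →
           (con 1ℤ :+ q :^ 3 :* c) :* (con 1ℤ :- q :^ 3 :* (c :* c)) :* ((con 1ℤ :- q :^ 4 :* (c :* c)) :* T)
           := (con 1ℤ :+ q :^ 3 :* c) :* (T :* (con 1ℤ :- q :^ 3 :* c :* c) :* (con 1ℤ :- q :^ 3 :* c :* (q :* c))))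
           refl q c T ⟩
    (1# + q ^ 3 * c) * (T * (1# - q ^ 3 * c * c) * (1# - q ^ 3 * c * (q * c)))
      ≈⟨ *-congˡ (trans (⟨⨾⟩-snoc (q ^ 3 * c) q (suc M)) (*-congʳ (⟨⨾⟩-snoc (q ^ 3 * c) q M))) ⟨
    (1# + q ^ 3 * c) * ⟨ q ^ 3 * c ⨾ q ⟩ suc (suc M)
      ≈⟨ *-congˡ (trans (⟨⨾⟩-cons (q ^ 3 * c) q (suc M))
           (*-congˡ (⟨⨾⟩-cong q (suc M) (solve 2 (λ q c → q :^ 3 :* c :* q := q :^ 3 :* (q :* c)) refl q c)))) ⟩
    (1# + q ^ 3 * c) * ((1# - q ^ 3 * c) * T′)
      -- (1 + q³c)(1 - q³c) = 1 - q⁶c², which is the outer factor 1 - q⁴(qc)² for the next index.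
      ≈⟨ solve 3 (λ q c T′ → (con 1ℤ :+ q :^ 3 :* c) :* ((con 1ℤ :- q :^ 3 :* c) :* T′)
           := (con 1ℤ :- q :^ 4 :* ((q :* c) :* (q :* c))) :* T′) refl q c T′ ⟩
    (1# - q ^ 4 * ((q * c) * (q * c))) * T′ ∎
    where
    c = q ^ M
    K = ⟨ - (q ^ 3) ⨾ q ⟩ M
    Z = ⟨ q ^ 3 ⨾ q ^ 2 ⟩ M
    T = ⟨ q ^ 3 * c ⨾ q ⟩ M
    T′ = ⟨ q ^ 3 * (q * c) ⨾ q ⟩ suc M

  -- Lets the reciprocal of 1 - q⁴ serve the Gaussian polynomial in base q², whose denominator
  -- contains 1 - (q²)².
  1-[b²]²-inverse : ∀ b {r} → (1# - b ^ 4) * r ≈ 1# → (1# - (b ^ 2) ^ 2) * r ≈ 1#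
  1-[b²]²-inverse b = trans (*-congʳ (+-congˡ (-‿cong (b²^[1+n] b 1))))

  -- The factor (b;b)_k cancels and leaves two numerator factors over (b;b)_2. Reciprocals are given
  -- by inverse equations, since an abstract ring has no division.
  gaussian₂ : ∀ b k {g r s} →
    (⟨ b ⨾ b ⟩ 2 * ⟨ b ⨾ b ⟩ k) * g ≈ 1# → (1# - b) * r ≈ 1# → (1# - b ^ 2) * s ≈ 1# →
    ⟨ b ⨾ b ⟩ (2 ℕ.+ k) * g ≈ ((1# - b ^ (2 ℕ.+ k)) * r) * ((1# - b ^ (1 ℕ.+ k)) * s)
  gaussian₂ b k {g} {r} {s} g-inv r-inv s-inv = begin
    ⟨ b ⨾ b ⟩ (2 ℕ.+ k) * g
      ≈⟨ *-congʳ (trans (⟨⨾⟩-snoc b b (suc k)) (*-congʳ (⟨⨾⟩-snoc b b k))) ⟩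
    B * (1# - b * d) * (1# - b * (b * d)) * g
      ≈⟨ *-identityʳ _ ⟨
    B * (1# - b * d) * (1# - b * (b * d)) * g * 1#
      -- The inserted 1 = (1 - b)(1 - b²) r s supplies the (b;b)_2 that `g` needs in order to
      -- cancel.
      ≈⟨ *-congˡ (*-inverse r-inv s-inv) ⟨
    B * (1# - b * d) * (1# - b * (b * d)) * g * (((1# - b) * (1# - b ^ 2)) * (r * s))
      ≈⟨ solve 6 (λ b d B g r s →
           B :* (con 1ℤ :- b :* d) :* (con 1ℤ :- b :* (b :* d)) :* g
             :* (((con 1ℤ :- b) :* (con 1ℤ :- b :^ 2)) :* (r :* s))
           := ((((con 1ℤ :- b :* con 1ℤ) :* ((con 1ℤ :- b :* (b :* con 1ℤ)) :* con 1ℤ)) :* B) :* g)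
             :* (((con 1ℤ :- b :* (b :* d)) :* r) :* ((con 1ℤ :- b :* d) :* s))) refl b d B g r s ⟩
    ((⟨ b ⨾ b ⟩ 2 * B) * g) * (((1# - b * (b * d)) * r) * ((1# - b * d) * s))
      ≈⟨ *-congʳ g-inv ⟩
    1# * (((1# - b * (b * d)) * r) * ((1# - b * d) * s))
      ≈⟨ *-identityˡ _ ⟩
    ((1# - b * (b * d)) * r) * ((1# - b * d) * s) ∎
    where
    d = b ^ k
    B = ⟨ b ⨾ b ⟩ k

  -- In the theorem r₁, r₂, r₄ and z are the reciprocals of 1 - q, 1 - q²,
  -- 1 - q⁴ and (q³;q²)_M, while y = q^(2M) and F = (-q³;q)_{2M}.
  difference : ∀ q y {r₁ r₂ r₄} z F → (1# - q) * r₁ ≈ 1# → (1# - q ^ 4) * r₄ ≈ 1# →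
    (r₁ * z) * ((1# - q ^ 2 * y) * r₂ + q ^ 3 * (((1# - q ^ 2 * y) * r₂) * ((1# - y) * r₄)))
      - q * (((1# - q ^ 2 * y) * r₂) * ((1# - q * y) * r₁)) * F
    ≈ ((1# - q ^ 2 * y) * r₂)
        * ((1# + q ^ 3 + q ^ 2 * y) * (r₄ * z) + q * ((1# - q * y) * r₁) * (r₄ * z - F))
  difference q y {r₁} {r₂} {r₄} z F r₁-inv r₄-inv = begin
    (r₁ * z) * (P + q ^ 3 * (P * ((1# - y) * r₄))) - q * (P * S) * F
      ≈⟨ +-congʳ (*-congˡ (+-congʳ (trans (*-congˡ r₄-inv) (*-identityʳ P)))) ⟨
    (r₁ * z) * (P * ((1# - q ^ 4) * r₄) + q ^ 3 * (P * ((1# - y) * r₄))) - q * (P * S) * F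
      -- The decisive identity, for the coefficient of P r₁ r₄ z: 1 - q⁴ + q³(1 - y) = (1 + q³ +
      -- q²y)(1 - q) + q(1 - qy).
      ≈⟨ solve 7 (λ q y r₁ r₄ z F P →
           (r₁ :* z) :* (P :* ((con 1ℤ :- q :^ 4) :* r₄) :+ q :^ 3 :* (P :* ((con 1ℤ :- y) :* r₄)))
             :- q :* (P :* ((con 1ℤ :- q :* y) :* r₁)) :* F
           := P :* ((con 1ℤ :+ q :^ 3 :+ q :^ 2 :* y) :* (r₄ :* z) :* ((con 1ℤ :- q) :* r₁)
                :+ q :* ((con 1ℤ :- q :* y) :* r₁) :* (r₄ :* z :- F))) refl q y r₁ r₄ z F P ⟩
    P * ((1# + q ^ 3 + q ^ 2 * y) * (r₄ * z) * ((1# - q) * r₁) + q * S * (r₄ * z - F))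
      ≈⟨ *-congˡ (+-congʳ (trans (*-congˡ r₁-inv) (*-identityʳ _))) ⟩
    P * ((1# + q ^ 3 + q ^ 2 * y) * (r₄ * z) + q * S * (r₄ * z - F)) ∎
    where
    P = (1# - q ^ 2 * y) * r₂
    S = (1# - q * y) * r₁

  -- One step of the geometric series. It separates the leading 1 and, for power series with x(0) =
  -- 0, gives a recursion for the coefficients of g.
  1-x-unfold : ∀ {x g} → (1# - x) * g ≈ 1# → g ≈ 1# + x * g
  1-x-unfold {x} {g} inv = begin
    g                       ≈⟨ solve 2 (λ x g → g := (con 1ℤ :- x) :* g :+ x :* g) refl x g ⟩
    (1# - x) * g + x * g    ≈⟨ +-congʳ inv ⟩
    1# + x * g              ∎

  1-[-a]d : ∀ a d → 1# - (- a) * d ≈ 1# + a * d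
  1-[-a]d = solve 2 (λ a d → con 1ℤ :- (:- a) :* d := con 1ℤ :+ a :* d) refl

  -- With x = ad, (1 + x)(1 - x) = 1 - x², so 1/(1 - x) exceeds 1 + x by x²/(1 - x). This is the
  -- comparison for a single factor.
  1-[-a]d-difference : ∀ a d {g} → (1# - a * d) * g ≈ 1# → g - (1# - (- a) * d) ≈ (a * d) * (a * d) * g
  1-[-a]d-difference a d {g} inv = begin
    g - (1# - (- a) * d)
      ≈⟨ solve 3 (λ a d g → g :- (con 1ℤ :- (:- a) :* d)
           := (con 1ℤ :+ a :* d) :* ((con 1ℤ :- a :* d) :* g) :- (con 1ℤ :+ a :* d) :+ (a :* d) :* (a :* d) :* g)
           refl a d g ⟩
    (1# + a * d) * ((1# - a * d) * g) - (1# + a * d) + (a * d) * (a * d) * g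
      ≈⟨ +-congʳ (+-congʳ (trans (*-congˡ inv) (*-identityʳ _))) ⟩
    (1# + a * d) - (1# + a * d) + (a * d) * (a * d) * g
      ≈⟨ trans (+-congʳ (-‿inverseʳ _)) (+-identityˡ _) ⟩
    (a * d) * (a * d) * g ∎

  -- Horner's rule for 1 + b + ... + b^n, which makes finite geometric sums accessible to induction.
  geometric-step : ∀ b n {r} → (1# - b) * r ≈ 1# → (1# - b ^ suc n) * r ≈ 1# + b * ((1# - b ^ n) * r)
  geometric-step b n {r} inv = begin
    (1# - b * b ^ n) * r
      ≈⟨ solve 3 (λ b d r → (con 1ℤ :- b :* d) :* r := (con 1ℤ :- b) :* r :+ b :* ((con 1ℤ :- d) :* r)) refl b (b ^ n) r ⟩
    (1# - b) * r + b * ((1# - b ^ n) * r)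
      ≈⟨ +-congʳ inv ⟩
    1# + b * ((1# - b ^ n) * r) ∎

  -- The mixed product x y′ is inserted, so only x and y′ multiply the differences of factors.
  *-difference : ∀ x x′ y y′ → x * y - x′ * y′ ≈ x * (y - y′) + (x - x′) * y′
  *-difference = solve 4 (λ x x′ y y′ → x :* y :- x′ :* y′ := x :* (y :- y′) :+ (x :- x′) :* y′) refl

  -- By `dissection` the quotient is K u t, and cutting the 2M factors at M takes K out of the
  -- product too. Writing u = 1 + x u then isolates `t - F′`, which can be compared factor by
  -- factor.
  quotient-difference : ∀ q M {r₄ z u t} →
    (1# - q ^ 4) * r₄ ≈ 1# → ⟨ q ^ 3 ⨾ q ^ 2 ⟩ M * z ≈ 1# →
    (1# - q ^ 4 * (q ^ M * q ^ M)) * u ≈ 1# → ⟨ q ^ 3 * q ^ M ⨾ q ⟩ M * t ≈ 1# →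
    r₄ * z - ⟨ - (q ^ 3) ⨾ q ⟩ (M ℕ.+ M)
      ≈ ⟨ - (q ^ 3) ⨾ q ⟩ M * ((t - ⟨ - (q ^ 3 * q ^ M) ⨾ q ⟩ M) + q ^ 4 * (q ^ M * q ^ M) * u * t)
  quotient-difference q M {r₄} {z} {u} {t} r₄-inv z-inv u-inv t-inv = begin
    r₄ * z - ⟨ - (q ^ 3) ⨾ q ⟩ (M ℕ.+ M)
      ≈⟨ +-cong quotient (-‿cong (trans (⟨⨾⟩-+ (- (q ^ 3)) q M M)
           (*-congˡ (⟨⨾⟩-cong q M (solve 2 (λ a c → (:- a) :* c := :- (a :* c)) refl (q ^ 3) (q ^ M)))))) ⟩
    K * (u * t) - K * F′
      ≈⟨ solve 4 (λ K u t F′ → K :* (u :* t) :- K :* F′ := K :* (u :* t :- F′)) refl K u t F′ ⟩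
    K * (u * t - F′)
      ≈⟨ *-congˡ (+-congʳ (*-congʳ (1-x-unfold u-inv))) ⟩
    K * ((1# + x * u) * t - F′)
      ≈⟨ *-congˡ (solve 4 (λ x u t F′ → (con 1ℤ :+ x :* u) :* t :- F′ := (t :- F′) :+ x :* u :* t) refl x u t F′) ⟩
    K * ((t - F′) + x * u * t) ∎
    where
    x = q ^ 4 * (q ^ M * q ^ M)
    K = ⟨ - (q ^ 3) ⨾ q ⟩ M
    Z = ⟨ q ^ 3 ⨾ q ^ 2 ⟩ M
    T = ⟨ q ^ 3 * q ^ M ⨾ q ⟩ M
    F′ = ⟨ - (q ^ 3 * q ^ M) ⨾ q ⟩ M
    quotient : r₄ * z ≈ K * (u * t)
    quotient = begin
      r₄ * z
        ≈⟨ *-identityˡ _ ⟨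
      1# * (r₄ * z)
        -- The inserted (1 - x) T is traded by `dissection` for K (1 - q⁴) Z, and (1 - q⁴) Z cancels
        -- against r₄ z.
        ≈⟨ *-congʳ (*-inverse u-inv t-inv) ⟨
      (((1# - x) * T) * (u * t)) * (r₄ * z)
        ≈⟨ *-congʳ (*-congʳ (dissection q M)) ⟨
      ((K * ((1# - q ^ 4) * Z)) * (u * t)) * (r₄ * z)
        ≈⟨ solve 4 (λ K A B C → ((K :* A) :* B) :* C := (K :* B) :* (A :* C)) refl
             K ((1# - q ^ 4) * Z) (u * t) (r₄ * z) ⟩
      (K * (u * t)) * (((1# - q ^ 4) * Z) * (r₄ * z))
        ≈⟨ *-congˡ (*-inverse r₄-inv z-inv) ⟩
      (K * (u * t)) * 1#
        ≈⟨ *-identityʳ _ ⟩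
      K * (u * t) ∎

  -- Brings the two sides of the theorem, with M = L - 2, into the shape of `difference` by setting
  -- y = q^(2M).
  pochhammer-difference : ∀ q M {o r₁ r₂ r₄ z G₁ G₂} F →
    ⟨ q ⨾ q ^ 2 ⟩ suc M * o ≈ 1# → (1# - q) * r₁ ≈ 1# → (1# - q ^ 4) * r₄ ≈ 1# → ⟨ q ^ 3 ⨾ q ^ 2 ⟩ M * z ≈ 1# →
    G₁ ≈ ((1# - q ^ (2 ℕ.+ (M ℕ.+ M))) * r₁) * ((1# - q ^ (1 ℕ.+ (M ℕ.+ M))) * r₂) →
    G₂ ≈ ((1# - (q ^ 2) ^ suc M) * r₂) * ((1# - (q ^ 2) ^ M) * r₄) →
    (1# * o) * ((1# - q ^ (2 ℕ.+ (M ℕ.+ M))) * r₂ + q ^ 3 * G₂) - q * G₁ * F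
    ≈ ((1# - q ^ (2 ℕ.+ (M ℕ.+ M))) * r₂)
        * ((1# + q ^ 3 + q ^ (2 ℕ.+ (M ℕ.+ M))) * (r₄ * z)
           + q * ((1# - q ^ (1 ℕ.+ (M ℕ.+ M))) * r₁) * (r₄ * z - F))
  pochhammer-difference q M {o} {r₁} {r₂} {r₄} {z} {G₁} {G₂} F o-inv r₁-inv r₄-inv z-inv G₁-eq G₂-eq = begin
    (1# * o) * ((1# - q²ᴺ) * r₂ + q ^ 3 * G₂) - q * G₁ * F
      ≈⟨ +-cong
           (*-cong (trans (*-identityˡ o) o≈) (+-cong (*-congʳ q²ᴺ-eq) (*-congˡ
             (trans G₂-eq (*-cong (*-congʳ 1-b^N-eq) (*-congʳ (+-congˡ (-‿cong (b*b^n q M)))))))))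
           (-‿cong (*-congʳ (*-congˡ (trans G₁-eq
             (trans (*-cong (*-congʳ q²ᴺ-eq) (*-congʳ q²ᴺ⁻¹-eq))
               -- The numerators swap denominators: 1 - q² divides the one with even exponent 2M + 2
               -- and 1 - q the other, so both quotients are finite geometric sums.
               (solve 4 (λ A B r₁ r₂ → (A :* r₁) :* (B :* r₂) := (A :* r₂) :* (B :* r₁)) refl
                 (1# - q ^ 2 * y) (1# - q * y) r₁ r₂)))))) ⟩
    (r₁ * z) * ((1# - q ^ 2 * y) * r₂ + q ^ 3 * (((1# - q ^ 2 * y) * r₂) * ((1# - y) * r₄)))
      - q * (((1# - q ^ 2 * y) * r₂) * ((1# - q * y) * r₁)) * F
      ≈⟨ difference q y z F r₁-inv r₄-inv ⟩
    ((1# - q ^ 2 * y) * r₂)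
        * ((1# + q ^ 3 + q ^ 2 * y) * (r₄ * z) + q * ((1# - q * y) * r₁) * (r₄ * z - F))
      ≈⟨ *-cong (*-congʳ q²ᴺ-eq)
           (+-cong (*-congʳ (+-congˡ q^2*y)) (*-congʳ (*-congˡ (*-congʳ q²ᴺ⁻¹-eq)))) ⟨
    ((1# - q²ᴺ) * r₂)
        * ((1# + q ^ 3 + q²ᴺ) * (r₄ * z) + q * ((1# - q ^ (1 ℕ.+ (M ℕ.+ M))) * r₁) * (r₄ * z - F)) ∎
    where
    y = q ^ M * q ^ M
    q²ᴺ = q ^ (2 ℕ.+ (M ℕ.+ M))
    q^2*y : q²ᴺ ≈ q ^ 2 * y
    q^2*y = trans (*-congˡ (*-congˡ (^-homo-* q M M)))
      (solve 2 (λ q y → q :* (q :* y) := q :^ 2 :* y) refl q y)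
    q²ᴺ-eq : 1# - q²ᴺ ≈ 1# - q ^ 2 * y
    q²ᴺ-eq = +-congˡ (-‿cong q^2*y)
    q²ᴺ⁻¹-eq : 1# - q ^ (1 ℕ.+ (M ℕ.+ M)) ≈ 1# - q * y
    q²ᴺ⁻¹-eq = +-congˡ (-‿cong (*-congˡ (^-homo-* q M M)))
    1-b^N-eq : 1# - (q ^ 2) ^ suc M ≈ 1# - q ^ 2 * y
    1-b^N-eq = +-congˡ (-‿cong (*-congˡ (b*b^n q M)))
    o≈ : o ≈ r₁ * z
    -- `q * q ^ 2` unfolds to `q ^ 3`, so splitting off the first factor leaves exactly the product
    -- that z inverts.
    o≈ = inverse-unique o-inv (trans (*-congʳ (⟨⨾⟩-cons q (q ^ 2) M)) (*-inverse r₁-inv z-inv))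

  -- An inverse of a product, times some of the factors, inverts the remaining ones. Inductions on n
  -- thus obtain all inverses from the single t.
  ⟨⨾⟩⁻¹-init : ∀ a b n {t} → ⟨ a ⨾ b ⟩ suc n * t ≈ 1# → ⟨ a ⨾ b ⟩ n * ((1# - a * b ^ n) * t) ≈ 1#
  ⟨⨾⟩⁻¹-init a b n inv = trans (sym (*-assoc _ _ _)) (trans (*-congʳ (sym (⟨⨾⟩-snoc a b n))) inv)

  ⟨⨾⟩⁻¹-last : ∀ a b n {t} → ⟨ a ⨾ b ⟩ suc n * t ≈ 1# → (1# - a * b ^ n) * (⟨ a ⨾ b ⟩ n * t) ≈ 1#
  ⟨⨾⟩⁻¹-last a b n {t} inv = trans
    (solve 3 (λ A B t → B :* (A :* t) := A :* (B :* t)) refl (⟨ a ⨾ b ⟩ n) (1# - a * b ^ n) t)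
    (⟨⨾⟩⁻¹-init a b n inv)

  ⟨⨾⟩⁻¹-snoc : ∀ a b n {t} → ⟨ a ⨾ b ⟩ suc n * t ≈ 1# →
               ((1# - a * b ^ n) * t) * (⟨ a ⨾ b ⟩ n * t) ≈ t
  ⟨⨾⟩⁻¹-snoc a b n {t} inv = begin
    ((1# - a * b ^ n) * t) * (⟨ a ⨾ b ⟩ n * t)
      ≈⟨ solve 3 (λ A B t → (B :* t) :* (A :* t) := (A :* (B :* t)) :* t) refl (⟨ a ⨾ b ⟩ n) (1# - a * b ^ n) t ⟩
    (⟨ a ⨾ b ⟩ n * ((1# - a * b ^ n) * t)) * t
      ≈⟨ *-congʳ (⟨⨾⟩⁻¹-init a b n inv) ⟩
    1# * t
      ≈⟨ *-identityˡ t ⟩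
    t ∎

-- Positive cones and domination of products.

record PositiveCone {κ ℓ} (R : CommutativeRing κ ℓ) : Set (Level.suc 0ℓ ⊔ κ ⊔ ℓ) where
  open CommutativeRing R
  field
    Nonneg           : Carrier → Set
    -- In the application: the constant term vanishes.
    Small            : Carrier → Set
    nonneg-resp-≈    : ∀ {x y} → x ≈ y → Nonneg x → Nonneg y
    1-nonneg         : Nonneg 1#
    +-nonneg         : ∀ {x y} → Nonneg x → Nonneg y → Nonneg (x + y)
    *-nonneg         : ∀ {x y} → Nonneg x → Nonneg y → Nonneg (x * y)
    *-small          : ∀ {x} y → Small x → Small (x * y)
    -- Stands in for the series 1 + x + x² + ..., an infinite sum that an abstract ring cannot
    -- express.
    1-x⁻¹-nonneg     : ∀ {x g} → Small x → Nonneg x → (1# - x) * g ≈ 1# → Nonneg g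
    0-nonneg         : Nonneg 0#

module Positivity {κ ℓ} (R : CommutativeRing κ ℓ) (cone : PositiveCone R) where
  open CommutativeRing R
  open Exp commutativeSemiring
  open IntegerCoefficients R using (solve; con; _:=_; _:+_; _:*_; _:-_; :-_)
  open Pochhammer R
  open PositiveCone cone

  ^-nonneg : ∀ {x} n → Nonneg x → Nonneg (x ^ n)
  ^-nonneg zero    x≥0 = 1-nonneg
  ^-nonneg (suc n) x≥0 = *-nonneg x≥0 (^-nonneg n x≥0)

  geometric-nonneg : ∀ {b r} n → Nonneg b → (1# - b) * r ≈ 1# → Nonneg ((1# - b ^ n) * r)
  geometric-nonneg {b} {r} zero    b≥0 inv = nonneg-resp-≈
    (solve 1 (λ r → con 0ℤ := (con 1ℤ :- con 1ℤ) :* r) refl r) 0-nonneg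
  geometric-nonneg {b}     (suc n) b≥0 inv = nonneg-resp-≈ (sym (geometric-step b n inv))
    (+-nonneg 1-nonneg (*-nonneg b≥0 (geometric-nonneg n b≥0 inv)))

  1-[-a]d-nonneg : ∀ {a d} → Nonneg a → Nonneg d → Nonneg (1# - (- a) * d)
  1-[-a]d-nonneg {a} {d} a≥0 d≥0 = nonneg-resp-≈ (sym (1-[-a]d a d)) (+-nonneg 1-nonneg (*-nonneg a≥0 d≥0))

  ⟨-a⨾⟩-nonneg : ∀ {a b} n → Nonneg a → Nonneg b → Nonneg (⟨ - a ⨾ b ⟩ n)
  ⟨-a⨾⟩-nonneg zero a≥0 b≥0 = 1-nonneg
  ⟨-a⨾⟩-nonneg {a} {b} (suc n) a≥0 b≥0 = nonneg-resp-≈ (sym (⟨⨾⟩-snoc (- a) b n))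
    (*-nonneg (⟨-a⨾⟩-nonneg n a≥0 b≥0) (1-[-a]d-nonneg a≥0 (^-nonneg n b≥0)))

  ⟨a⨾⟩⁻¹-nonneg : ∀ {a b t} n → Small a → Nonneg a → Nonneg b → ⟨ a ⨾ b ⟩ n * t ≈ 1# → Nonneg t
  ⟨a⨾⟩⁻¹-nonneg {t = t} zero a-small a≥0 b≥0 inv = nonneg-resp-≈ (trans (sym inv) (*-identityˡ t)) 1-nonneg
  ⟨a⨾⟩⁻¹-nonneg {a} {b} {t} (suc n) a-small a≥0 b≥0 inv = nonneg-resp-≈ (⟨⨾⟩⁻¹-snoc a b n inv)
    (*-nonneg (⟨a⨾⟩⁻¹-nonneg n a-small a≥0 b≥0 (⟨⨾⟩⁻¹-init a b n inv))
      (1-x⁻¹-nonneg (*-small (b ^ n) a-small) (*-nonneg a≥0 (^-nonneg n b≥0)) (⟨⨾⟩⁻¹-last a b n inv)))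

  -- Factor by factor: with t′ and g the inverses of the first n factors and of the last, the
  -- difference is t′ (g - (1 + ad)) plus the previous difference times 1 + ad. The first bracket is
  -- (ad)² g.
  ⟨a⨾⟩⁻¹-dominates : ∀ {a b t} n → Small a → Nonneg a → Nonneg b → ⟨ a ⨾ b ⟩ n * t ≈ 1# →
                     Nonneg (t - ⟨ - a ⨾ b ⟩ n)
  ⟨a⨾⟩⁻¹-dominates {t = t} zero a-small a≥0 b≥0 inv = nonneg-resp-≈
    (sym (trans (+-congʳ (trans (sym (*-identityˡ t)) inv)) (-‿inverseʳ 1#))) 0-nonneg
  ⟨a⨾⟩⁻¹-dominates {a} {b} {t} (suc n) a-small a≥0 b≥0 inv = nonneg-resp-≈
    (trans (sym (*-difference _ (⟨ - a ⨾ b ⟩ n) _ (1# - (- a) * d)))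
      (+-cong (⟨⨾⟩⁻¹-snoc a b n inv) (-‿cong (sym (⟨⨾⟩-snoc (- a) b n)))))
    (+-nonneg
      (*-nonneg (⟨a⨾⟩⁻¹-nonneg n a-small a≥0 b≥0 t′-inv)
        (nonneg-resp-≈ (sym (1-[-a]d-difference a d g-inv))
          (*-nonneg (*-nonneg ad≥0 ad≥0) (1-x⁻¹-nonneg (*-small d a-small) ad≥0 g-inv))))
      (*-nonneg (⟨a⨾⟩⁻¹-dominates n a-small a≥0 b≥0 t′-inv) (1-[-a]d-nonneg a≥0 d≥0)))
    where
    d = b ^ n
    d≥0 : Nonneg d
    d≥0 = ^-nonneg n b≥0
    ad≥0 : Nonneg (a * d)
    ad≥0 = *-nonneg a≥0 d≥0
    t′-inv = ⟨⨾⟩⁻¹-init a b n inv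
    g-inv = ⟨⨾⟩⁻¹-last a b n inv

  module _ {q} (q-small : Small q) (q≥0 : Nonneg q) (M : ℕ) {r₁ r₂ r₄ z u t}
    (r₁-inv : (1# - q) * r₁ ≈ 1#) (r₂-inv : (1# - q ^ 2) * r₂ ≈ 1#) (r₄-inv : (1# - q ^ 4) * r₄ ≈ 1#)
    (z-inv : ⟨ q ^ 3 ⨾ q ^ 2 ⟩ M * z ≈ 1#)
    (u-inv : (1# - q ^ 4 * (q ^ M * q ^ M)) * u ≈ 1#) (t-inv : ⟨ q ^ 3 * q ^ M ⨾ q ⟩ M * t ≈ 1#)
    where

    -- This is E ⪰ F. In `quotient-difference`, K is a product of factors 1 + q^j, the term in t is
    -- the comparison for a = q^(M+3), and the rest is a product of nonnegative elements.
    quotient-dominates : Nonneg (r₄ * z - ⟨ - (q ^ 3) ⨾ q ⟩ (M ℕ.+ M))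
    quotient-dominates = nonneg-resp-≈
      (sym (quotient-difference q M r₄-inv z-inv u-inv t-inv))
      (*-nonneg (⟨-a⨾⟩-nonneg M (^-nonneg 3 q≥0) q≥0)
        (+-nonneg (⟨a⨾⟩⁻¹-dominates M a-small a≥0 q≥0 t-inv)
          (*-nonneg (*-nonneg x≥0 (1-x⁻¹-nonneg (*-small _ (*-small _ q-small)) x≥0 u-inv))
            (⟨a⨾⟩⁻¹-nonneg M a-small a≥0 q≥0 t-inv))))
      where
      a-small : Small (q ^ 3 * q ^ M)
      a-small = *-small _ (*-small _ q-small)
      a≥0 : Nonneg (q ^ 3 * q ^ M)
      a≥0 = *-nonneg (^-nonneg 3 q≥0) (^-nonneg M q≥0)
      x≥0 : Nonneg (q ^ 4 * (q ^ M * q ^ M))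
      x≥0 = *-nonneg (^-nonneg 4 q≥0) (*-nonneg (^-nonneg M q≥0) (^-nonneg M q≥0))

    pochhammer-inequality : ∀ {o G₁ G₂} → ⟨ q ⨾ q ^ 2 ⟩ suc M * o ≈ 1# →
      G₁ ≈ ((1# - q ^ (2 ℕ.+ (M ℕ.+ M))) * r₁) * ((1# - q ^ (1 ℕ.+ (M ℕ.+ M))) * r₂) →
      G₂ ≈ ((1# - (q ^ 2) ^ suc M) * r₂) * ((1# - (q ^ 2) ^ M) * r₄) →
      Nonneg ((1# * o) * ((1# - q ^ (2 ℕ.+ (M ℕ.+ M))) * r₂ + q ^ 3 * G₂)
              - q * G₁ * ⟨ - (q ^ 3) ⨾ q ⟩ (M ℕ.+ M))
    pochhammer-inequality o-inv G₁-eq G₂-eq = nonneg-resp-≈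
      (sym (pochhammer-difference q M _ o-inv r₁-inv r₄-inv z-inv G₁-eq G₂-eq))
      (*-nonneg
        -- P is the geometric sum in q² with M + 1 terms, so its exponent is first read as a power
        -- of q².
        (nonneg-resp-≈ (*-congʳ (+-congˡ (-‿cong (b²^[1+n] q M))))
          (geometric-nonneg (suc M) (^-nonneg 2 q≥0) r₂-inv))
        (+-nonneg
          (*-nonneg
            (+-nonneg (+-nonneg 1-nonneg (^-nonneg 3 q≥0)) (^-nonneg (2 ℕ.+ (M ℕ.+ M)) q≥0))
            (*-nonneg (1-x⁻¹-nonneg (*-small _ q-small) (^-nonneg 4 q≥0) r₄-inv)
              (⟨a⨾⟩⁻¹-nonneg M (*-small _ q-small) (^-nonneg 3 q≥0) (^-nonneg 2 q≥0) z-inv)))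
          (*-nonneg (*-nonneg q≥0 (geometric-nonneg (1 ℕ.+ (M ℕ.+ M)) q≥0 r₁-inv)) quotient-dominates)))

open import Defs

open IntegerCoefficients ℤ.+-*-commutativeRing using (solve; con; _:=_; _:+_; _:*_)

-- The commutative ring of formal power series.

shift : PowerSeries → PowerSeries
shift f = f ∘ suc

*-cong : ∀ {f f′ g g′} → f ≈ f′ → g ≈ g′ → f * g ≈ f′ * g′
*-cong f≈f′ g≈g′ zero    = ≡.cong₂ (λ u v → u ℤ.* v ℤ.+ 0ℤ) (f≈f′ 0) (g≈g′ 0)
*-cong f≈f′ g≈g′ (suc n) =
  ≡.cong₂ ℤ._+_ (≡.cong₂ ℤ._*_ (f≈f′ 0) (g≈g′ (suc n))) (*-cong (f≈f′ ∘ suc) g≈g′ n)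

-- By definition (f * g) (suc n) unfolds along f; this is the unfolding along g.
*-suc : ∀ f g n → (f * g) (suc n) ≡ f (suc n) ℤ.* g 0 ℤ.+ (f * shift g) n
*-suc f g zero    = solve 4 (λ a b c d → a :* d :+ (b :* c :+ con 0ℤ) := b :* c :+ (a :* d :+ con 0ℤ))
                      ≡.refl (f 0) (f 1) (g 0) (g 1)
*-suc f g (suc n) = ≡.trans (≡.cong (λ s → f 0 ℤ.* g (2 ℕ.+ n) ℤ.+ s) (*-suc (shift f) g n))
  (solve 3 (λ a b c → a :+ (b :+ c) := b :+ (a :+ c)) ≡.refl
     (f 0 ℤ.* g (2 ℕ.+ n)) (f (2 ℕ.+ n) ℤ.* g 0) ((shift f * shift g) n))

-- Unfolding f * g along its left factor and g * f along its right factor shifts f in both, so the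
-- induction hypothesis matches.
*-comm : ∀ f g → f * g ≈ g * f
*-comm f g zero    = ≡.cong (ℤ._+ 0ℤ) (ℤ.*-comm (f 0) (g 0))
*-comm f g (suc n) = ≡.trans
  (≡.cong₂ ℤ._+_ (ℤ.*-comm (f 0) (g (suc n))) (*-comm (shift f) g n)) (≡.sym (*-suc g f n))

*-distribʳ-+ : ∀ h f g → (f + g) * h ≈ f * h + g * h
*-distribʳ-+ h f g zero    = solve 3 (λ a b c → (a :+ b) :* c :+ con 0ℤ := (a :* c :+ con 0ℤ) :+ (b :* c :+ con 0ℤ))
                              ≡.refl (f 0) (g 0) (h 0)
*-distribʳ-+ h f g (suc n) = ≡.trans
  (≡.cong (λ s → (f 0 ℤ.+ g 0) ℤ.* h (suc n) ℤ.+ s) (*-distribʳ-+ h (shift f) (shift g) n))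
  (solve 5 (λ a b c u v → (a :+ b) :* c :+ (u :+ v) := (a :* c :+ u) :+ (b :* c :+ v)) ≡.refl
     (f 0) (g 0) (h (suc n)) ((shift f * h) n) ((shift g * h) n))

*-distribˡ-+ : ∀ h f g → h * (f + g) ≈ h * f + h * g
*-distribˡ-+ h f g n = ≡.trans (*-comm h (f + g) n)
  (≡.trans (*-distribʳ-+ h f g n) (≡.cong₂ ℤ._+_ (*-comm f h n) (*-comm g h n)))

scale-* : ∀ a f g n → ((λ i → a ℤ.* f i) * g) n ≡ a ℤ.* (f * g) n
scale-* a f g zero    = solve 3 (λ a u v → a :* u :* v :+ con 0ℤ := a :* (u :* v :+ con 0ℤ)) ≡.refl a (f 0) (g 0)
scale-* a f g (suc n) = ≡.trans (≡.cong (λ s → a ℤ.* f 0 ℤ.* g (suc n) ℤ.+ s) (scale-* a (shift f) g n))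
  (solve 4 (λ a u v w → a :* u :* v :+ a :* w := a :* (u :* v :+ w)) ≡.refl
     a (f 0) (g (suc n)) ((shift f * g) n))

-- The shift of f * g is by definition f(0) times `shift g`, plus `shift f * g`. Distributivity
-- separates the two; `scale-*` treats the first and induction the second.
*-assoc : ∀ f g h → (f * g) * h ≈ f * (g * h)
*-assoc f g h zero = solve 3 (λ a b c → (a :* b :+ con 0ℤ) :* c :+ con 0ℤ := a :* (b :* c :+ con 0ℤ) :+ con 0ℤ)
                       ≡.refl (f 0) (g 0) (h 0)
*-assoc f g h (suc n) = begin
  (f 0 ℤ.* g 0 ℤ.+ 0ℤ) ℤ.* h (suc n) ℤ.+ (((λ i → f 0 ℤ.* shift g i) + shift f * g) * h) n
    ≡⟨ ≡.cong (λ s → (f 0 ℤ.* g 0 ℤ.+ 0ℤ) ℤ.* h (suc n) ℤ.+ s)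
         (*-distribʳ-+ h (λ i → f 0 ℤ.* shift g i) (shift f * g) n) ⟩
  (f 0 ℤ.* g 0 ℤ.+ 0ℤ) ℤ.* h (suc n) ℤ.+ (((λ i → f 0 ℤ.* shift g i) * h) n ℤ.+ ((shift f * g) * h) n)
    ≡⟨ ≡.cong (λ s → (f 0 ℤ.* g 0 ℤ.+ 0ℤ) ℤ.* h (suc n) ℤ.+ s)
         (≡.cong₂ ℤ._+_ (scale-* (f 0) (shift g) h n) (*-assoc (shift f) g h n)) ⟩
  (f 0 ℤ.* g 0 ℤ.+ 0ℤ) ℤ.* h (suc n) ℤ.+ (f 0 ℤ.* (shift g * h) n ℤ.+ (shift f * (g * h)) n)
    ≡⟨ solve 5 (λ a b c u v → (a :* b :+ con 0ℤ) :* c :+ (a :* u :+ v) := a :* (b :* c :+ u) :+ v) ≡.refl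
         (f 0) (g 0) (h (suc n)) ((shift g * h) n) ((shift f * (g * h)) n) ⟩
  f 0 ℤ.* (g 0 ℤ.* h (suc n) ℤ.+ (shift g * h) n) ℤ.+ (shift f * (g * h)) n ∎
  where open ≡.≡-Reasoning

*-zeroˡ : ∀ f → 0# * f ≈ 0#
*-zeroˡ f zero    = ≡.refl
*-zeroˡ f (suc n) = ≡.trans (ℤ.+-identityˡ _) (*-zeroˡ f n)

*-identityˡ : ∀ f → 1# * f ≈ f
*-identityˡ f zero    = ≡.trans (ℤ.+-identityʳ _) (ℤ.*-identityˡ (f 0))
*-identityˡ f (suc n) = ≡.trans (≡.cong₂ ℤ._+_ (ℤ.*-identityˡ (f (suc n))) (*-zeroˡ f n)) (ℤ.+-identityʳ _)

powerSeriesRing : CommutativeRing 0ℓ 0ℓ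
powerSeriesRing = record
  { Carrier = PowerSeries
  ; _≈_     = _≈_
  ; _+_     = _+_
  ; _*_     = _*_
  ; -_      = -_
  ; 0#      = 0#
  ; 1#      = 1#
  ; isCommutativeRing = record
    { isRing = record
      { +-isAbelianGroup = record
        { isGroup = record
          { isMonoid = record
            { isSemigroup = record
              { isMagma = record
                { isEquivalence = record
                  { refl  = λ _ → ≡.refl
                  ; sym   = λ f≈g n → ≡.sym (f≈g n)
                  ; trans = λ f≈g g≈h n → ≡.trans (f≈g n) (g≈h n)
                  }
                ; ∙-cong = λ f≈f′ g≈g′ n → ≡.cong₂ ℤ._+_ (f≈f′ n) (g≈g′ n)
                }
              ; assoc = λ f g h n → ℤ.+-assoc (f n) (g n) (h n)
              }
            ; identity = (λ f n → ℤ.+-identityˡ (f n)) , (λ f n → ℤ.+-identityʳ (f n))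
            }
          ; inverse = (λ f n → ℤ.+-inverseˡ (f n)) , (λ f n → ℤ.+-inverseʳ (f n))
          ; ⁻¹-cong = λ f≈g n → ≡.cong ℤ.-_ (f≈g n)
          }
        ; comm = λ f g n → ℤ.+-comm (f n) (g n)
        }
      ; *-cong     = *-cong
      ; *-assoc    = *-assoc
      ; *-identity = *-identityˡ , (λ f n → ≡.trans (*-comm f 1# n) (*-identityˡ f n))
      ; distrib    = *-distribˡ-+ , *-distribʳ-+
      }
    ; *-comm = *-comm
    }
  }

open CommutativeRing powerSeriesRing using ()
  renaming (refl to ≈-refl; sym to ≈-sym; trans to ≈-trans)
open Pochhammer powerSeriesRing hiding (⟨_⨾_⟩_)

-- Coefficientwise nonnegativity.

Nonneg : PowerSeries → Set
Nonneg f = ∀ n → 0ℤ ℤ.≤ f n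

nonneg-resp-≈ : ∀ {f g} → f ≈ g → Nonneg f → Nonneg g
nonneg-resp-≈ f≈g f≥0 n = ≡.subst (0ℤ ℤ.≤_) (f≈g n) (f≥0 n)

0-nonneg : Nonneg 0#
0-nonneg n = ℤ.≤-refl

1-nonneg : Nonneg 1#
1-nonneg zero    = ℤ.+≤+ ℕ.z≤n
1-nonneg (suc n) = ℤ.≤-refl

q-nonneg : Nonneg q
q-nonneg 0             = ℤ.≤-refl
q-nonneg 1             = ℤ.+≤+ ℕ.z≤n
q-nonneg (suc (suc n)) = ℤ.≤-refl

+-nonneg : ∀ {f g} → Nonneg f → Nonneg g → Nonneg (f + g)
+-nonneg f≥0 g≥0 n = ℤ.+-mono-≤ (f≥0 n) (g≥0 n)

ℤ-*-nonneg : ∀ {i j} → 0ℤ ℤ.≤ i → 0ℤ ℤ.≤ j → 0ℤ ℤ.≤ i ℤ.* j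
ℤ-*-nonneg {j = j} i≥0 j≥0 = ℤ.*-monoʳ-≤-nonNeg j {{ℤ.nonNegative j≥0}} i≥0

-- Coefficient n of a product sees g only up to n. The bounded hypothesis on g is what the strong
-- induction in `1-x-inverse-nonneg` can supply.
*-nonneg-upTo : ∀ f g n → Nonneg f → (∀ {i} → i ≤ n → 0ℤ ℤ.≤ g i) → 0ℤ ℤ.≤ (f * g) n
*-nonneg-upTo f g zero    f≥0 g≥0 = ℤ.+-mono-≤ (ℤ-*-nonneg (f≥0 0) (g≥0 ℕ.≤-refl)) ℤ.≤-refl
*-nonneg-upTo f g (suc n) f≥0 g≥0 = ℤ.+-mono-≤ (ℤ-*-nonneg (f≥0 0) (g≥0 ℕ.≤-refl))
  (*-nonneg-upTo (shift f) g n (f≥0 ∘ suc) (g≥0 ∘ ℕ.m≤n⇒m≤1+n))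

*-nonneg : ∀ {f g} → Nonneg f → Nonneg g → Nonneg (f * g)
*-nonneg {f} {g} f≥0 g≥0 n = *-nonneg-upTo f g n f≥0 (λ {i} _ → g≥0 i)

-- Strong induction on g = 1 + x g: since x(0) = 0, coefficient n + 1 of x g depends only on
-- coefficients of g up to n.
1-x-inverse-nonneg : ∀ {x g} → x 0 ≡ 0ℤ → Nonneg x → (1# - x) * g ≈ 1# → Nonneg g
1-x-inverse-nonneg {x} {g} x₀≡0 x≥0 inv n = upTo n ℕ.≤-refl
  where
  unfold : g ≈ 1# + x * g
  unfold = 1-x-unfold {x} {g} inv

  at-0 : 0ℤ ℤ.≤ g 0
  at-0 = ≡.subst (0ℤ ℤ.≤_)
    (≡.sym (≡.trans (unfold 0) (≡.cong (λ u → 1ℤ ℤ.+ (u ℤ.* g 0 ℤ.+ 0ℤ)) x₀≡0))) (ℤ.+≤+ ℕ.z≤n)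

  at-suc : ∀ n → (∀ {i} → i ≤ n → 0ℤ ℤ.≤ g i) → 0ℤ ℤ.≤ g (suc n)
  at-suc n g≥0 = ≡.subst (0ℤ ℤ.≤_) (≡.sym (≡.trans (unfold (suc n)) (ℤ.+-identityˡ _)))
    -- The one term containing the still unknown g(n + 1) has the factor x(0) = 0.
    (ℤ.+-mono-≤ (ℤ.≤-reflexive (≡.sym (≡.cong (ℤ._* g (suc n)) x₀≡0)))
                (*-nonneg-upTo (shift x) g n (x≥0 ∘ suc) g≥0))

  upTo : ∀ n {i} → i ≤ n → 0ℤ ℤ.≤ g i
  upTo zero ℕ.z≤n = at-0
  upTo (suc n) i≤1+n with ℕ.m≤n⇒m<n∨m≡n i≤1+n
  ... | inj₁ i<1+n  = upTo n (ℕ.s≤s⁻¹ i<1+n)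
  ... | inj₂ ≡.refl = at-suc n (upTo n)

-- Constant terms, reciprocals and Gaussian polynomials of power series.

0*-constant : ∀ {f} g → f 0 ≡ 0ℤ → (f * g) 0 ≡ 0ℤ
0*-constant g = ≡.cong (λ u → u ℤ.* g 0 ℤ.+ 0ℤ)

1-x-constant : ∀ {x} → x 0 ≡ 0ℤ → (1# - x) 0 ≡ 1ℤ
1-x-constant = ≡.cong (λ u → 1ℤ ℤ.- u)

⟨⨾⟩-constant : ∀ {a} b n → a 0 ≡ 0ℤ → (⟨ a ⨾ b ⟩ n) 0 ≡ 1ℤ
⟨⨾⟩-constant     b zero    a₀≡0 = ≡.refl
⟨⨾⟩-constant {a} b (suc n) a₀≡0 = ≡.trans (⟨⨾⟩-snoc a b n 0)
  (≡.cong₂ (λ u v → u ℤ.* v ℤ.+ 0ℤ) (⟨⨾⟩-constant {a} b n a₀≡0)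
    (1-x-constant {a * b ^ n} (0*-constant {a} (b ^ n) a₀≡0)))

1-x-recip : ∀ {x} → x 0 ≡ 0ℤ → (1# - x) * recip (1# - x) ≈ 1#
1-x-recip {x} x₀≡0 = *-recip (1# - x) (1-x-constant {x} x₀≡0)

⟨⨾⟩-recip : ∀ {a} b n → a 0 ≡ 0ℤ → ⟨ a ⨾ b ⟩ n * recip (⟨ a ⨾ b ⟩ n) ≈ 1#
⟨⨾⟩-recip {a} b n a₀≡0 = *-recip (⟨ a ⨾ b ⟩ n) (⟨⨾⟩-constant {a} b n a₀≡0)

gaussian-2+ : ∀ b k {r s} → b 0 ≡ 0ℤ → (1# - b) * r ≈ 1# → (1# - b ^ 2) * s ≈ 1# →
  gaussian b (2 ℕ.+ k) 2 ≈ ((1# - b ^ (2 ℕ.+ k)) * r) * ((1# - b ^ (1 ℕ.+ k)) * s)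
-- The test `2 ≤? 2 ℕ.+ k` computes to yes, so the Gaussian polynomial unfolds to the quotient in
-- `gaussian₂`.
gaussian-2+ b k {r} {s} b₀≡0 r-inv s-inv = gaussian₂ b k {recip denominator} {r} {s} denominator-inv r-inv s-inv
  where
  denominator : PowerSeries
  denominator = (⟨ b ⨾ b ⟩ 2) * (⟨ b ⨾ b ⟩ k)
  denominator-inv : denominator * recip denominator ≈ 1#
  denominator-inv = *-recip denominator
    (≡.cong₂ (λ u v → u ℤ.* v ℤ.+ 0ℤ) (⟨⨾⟩-constant {b} b 2 b₀≡0) (⟨⨾⟩-constant {b} b k b₀≡0))

gaussian-1+ : ∀ b m {r s} → b 0 ≡ 0ℤ → (1# - b) * r ≈ 1# → (1# - b ^ 2) * s ≈ 1# →
  gaussian b (1 ℕ.+ m) 2 ≈ ((1# - b ^ (1 ℕ.+ m)) * r) * ((1# - b ^ m) * s)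
gaussian-1+ b (suc k) {r} {s} b₀≡0 r-inv s-inv = gaussian-2+ b k {r} {s} b₀≡0 r-inv s-inv
-- The case L = 2: the Gaussian polynomial [1, 2] is 0 by convention, and the right side vanishes
-- through its factor 1 - b^0.
gaussian-1+ b zero {r} {s} b₀≡0 r-inv s-inv = ≈-sym (≈-trans
  (*-cong {(1# - b ^ 1) * r} ≈-refl (≈-trans (*-cong {g = s} (λ n → ℤ.+-inverseʳ (1# n)) ≈-refl) (*-zeroˡ s)))
  (≈-trans (*-comm ((1# - b ^ 1) * r) 0#) (*-zeroˡ ((1# - b ^ 1) * r))))

positiveCone : PositiveCone powerSeriesRing
positiveCone = record
  { Nonneg        = Nonneg
  ; Small         = λ f → f 0 ≡ 0ℤ
  ; nonneg-resp-≈ = nonneg-resp-≈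
  ; 1-nonneg      = 1-nonneg
  ; +-nonneg      = +-nonneg
  ; *-nonneg      = *-nonneg
  ; *-small       = λ {f} → 0*-constant {f}
  ; 1-x⁻¹-nonneg  = λ {x} {g} → 1-x-inverse-nonneg {x} {g}
  ; 0-nonneg      = 0-nonneg
  }

-- The inequality for power series.

open Positivity powerSeriesRing positiveCone using (pochhammer-inequality)

-- A variable x replaces q, of which only the zero constant term and the nonnegativity matter. With
-- M = L - 2 all indices are free of truncated subtraction.
inequality : ∀ x → x 0 ≡ 0ℤ → Nonneg x → ∀ M →
  (1# / (⟨ x ⨾ x ^ 2 ⟩ (suc M)))
  * ((1# - x ^ (2 ℕ.+ (M ℕ.+ M))) / (1# - x ^ 2) + x ^ 3 * gaussian (x ^ 2) (suc M) 2)
  ⪰ x * gaussian x (2 ℕ.+ (M ℕ.+ M)) 2 * (⟨ - (x ^ 3) ⨾ x ⟩ (M ℕ.+ M))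
inequality x x₀≡0 x≥0 M = pochhammer-inequality {x} x₀≡0 x≥0 M {r₁} {r₂} {r₄} {z} {u} {t}
  r₁-inv r₂-inv r₄-inv z-inv u-inv t-inv {o} {G₁} {G₂} o-inv
  (gaussian-2+ x (M ℕ.+ M) {r₁} {r₂} x₀≡0 r₁-inv r₂-inv)
  (gaussian-1+ (x ^ 2) M {r₂} {r₄} (x^[1+n]₀≡0 1) r₂-inv (1-[b²]²-inverse x {r₄} r₄-inv))
  where
  a y o r₁ r₂ r₄ z u t G₁ G₂ : PowerSeries
  a  = x ^ 3 * x ^ M
  y  = x ^ 4 * (x ^ M * x ^ M)
  o  = recip (⟨ x ⨾ x ^ 2 ⟩ (suc M))
  r₁ = recip (1# - x)
  r₂ = recip (1# - x ^ 2)
  r₄ = recip (1# - x ^ 4)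
  z  = recip (⟨ x ^ 3 ⨾ x ^ 2 ⟩ M)
  u  = recip (1# - y)
  t  = recip (⟨ a ⨾ x ⟩ M)
  G₁ = gaussian x (2 ℕ.+ (M ℕ.+ M)) 2
  G₂ = gaussian (x ^ 2) (suc M) 2
  x^[1+n]₀≡0 : ∀ n → (x ^ suc n) 0 ≡ 0ℤ
  x^[1+n]₀≡0 n = 0*-constant {x} (x ^ n) x₀≡0
  o-inv : ⟨ x ⨾ x ^ 2 ⟩ (suc M) * o ≈ 1#
  o-inv = ⟨⨾⟩-recip {x} (x ^ 2) (suc M) x₀≡0
  r₁-inv : (1# - x) * r₁ ≈ 1#
  r₁-inv = 1-x-recip {x} x₀≡0
  r₂-inv : (1# - x ^ 2) * r₂ ≈ 1#
  r₂-inv = 1-x-recip {x ^ 2} (x^[1+n]₀≡0 1)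
  r₄-inv : (1# - x ^ 4) * r₄ ≈ 1#
  r₄-inv = 1-x-recip {x ^ 4} (x^[1+n]₀≡0 3)
  z-inv : ⟨ x ^ 3 ⨾ x ^ 2 ⟩ M * z ≈ 1#
  z-inv = ⟨⨾⟩-recip {x ^ 3} (x ^ 2) M (x^[1+n]₀≡0 2)
  u-inv : (1# - y) * u ≈ 1#
  u-inv = 1-x-recip {y} (0*-constant {x ^ 4} (x ^ M * x ^ M) (x^[1+n]₀≡0 3))
  t-inv : ⟨ a ⨾ x ⟩ M * t ≈ 1#
  t-inv = ⟨⨾⟩-recip {a} x M (0*-constant {x ^ 3} (x ^ M) (x^[1+n]₀≡0 2))

2[2+n]∸2 : ∀ n → 2 ℕ.* (2 ℕ.+ n) ∸ 2 ≡ 2 ℕ.+ (n ℕ.+ n)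
2[2+n]∸2 n = ≡.trans (ℕ.+-suc n _) (2*[1+n] n)

theorem1p2 : ∀ (L : ℕ) → 2 ≤ L →
    (1# / (⟨ q ⨾ q ^ 2 ⟩ (L ∸ 1)))
    * ((1# - q ^ (2 ℕ.* L ∸ 2)) / (1# - q ^ 2) + q ^ 3 * gaussian (q ^ 2) (L ∸ 1) 2)
    ⪰ q * gaussian q (2 ℕ.* L ∸ 2) 2 * (⟨ - (q ^ 3) ⨾ q ⟩ (2 ℕ.* L ∸ 4))
-- For L = M + 2, 2L - 2 becomes 2 + (M + M), and 2L - 4, read as (2L - 2) - 2, becomes M + M.
theorem1p2 (suc (suc M)) (ℕ.s≤s (ℕ.s≤s ℕ.z≤n)) = ≡.subst₂
  (λ m n → (1# / (⟨ q ⨾ q ^ 2 ⟩ (suc M))) * ((1# - q ^ m) / (1# - q ^ 2) + q ^ 3 * gaussian (q ^ 2) (suc M) 2)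
           ⪰ q * gaussian q m 2 * (⟨ - (q ^ 3) ⨾ q ⟩ n))
  (≡.sym (2[2+n]∸2 M)) (≡.sym (≡.trans (ℕ.∸-+-assoc (2 ℕ.* (2 ℕ.+ M)) 2 2) (≡.cong (_∸ 2) (2[2+n]∸2 M))))
  (inequality q ≡.refl q-nonneg M)
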